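{- Let $\mathbf s=(s_1,\dots,s_l)$ be a sequence of positive integers with $\mathbf s\neq(1)$. Then $$T(\mathbf s)=\sum_{i\in S_1(\mathbf s)}T(s_1,\dots,s_i-1,\dots,s_l)+\sum_{i\in S_2(\mathbf s)}T(s_1,\dots,s_{i-1},s_i+s_{i+1}-1,s_{i+2},\dots,s_l),$$ with the initial condition $T(1)=1$. Here, in the term $i=l$ of the first sum, if $s_l=1$ the resulting last entry $0$ is deleted, i.e. the argument is $(s_1,\dots,s_{l-1})$.
   Context: A noncommutative crossing partition of $[n]=\{1,\dots,n\}$ is a finite sequence $\pi=(\pi_1,\dots,\pi_l)$ of nonempty blocks such that each $p\in[n]$ appears exactly once in $\pi$, each block is written as an increasing sequence, and $\max(\pi_i)>\min(\pi_{i+1})$ for $1\le i\le l-1$. It is of type $(s_1,\dots,s_l)$ if $\pi_i$ has $s_i$ elements for each $i$. For a sequence $\mathbf s=(s_1,\dots,s_l)$ of positive integers with sum $n$, $T(\mathbf s)$ is the number of noncommutative crossing partitions of $[n]$ of type $\mathbf s$. Define $$S_1(\mathbf s)=\{i\le l-1: s_i>1\}\cup\{l\},\qquad S_2(\mathbf s)=\{i\le l-1: s_{i+1}\ge2\}.$$ -}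

module Defs where

open import Data.Nat using (ℕ; zero; suc; pred; _+_; _∸_; _⊔_; _⊓_; _≤_; _<_; _>_; _<?_; _≤?_)
open import Data.Nat.ListAction using (sum)
import Data.Nat.Properties as ℕ
open import Data.Fin as Fin using (Fin; zero; suc; toℕ; fromℕ; inject₁)
import Data.Fin.Properties as Fin
open import Data.List as List using (List; []; _∷_; [_]; cartesianProductWith; allFin; filter)
import Data.List.Properties as List
open import Data.List.NonEmpty as List⁺ using (List⁺; _∷_)
open import Data.List.Membership.Propositional using (_∈_)
open import Data.List.Membership.Propositional.Properties
  using (∈-allFin; ∈-cartesianProductWith⁺; ∈-cartesianProductWith⁻; ∈-filter⁺; ∈-filter⁻)
open import Data.List.Relation.Unary.All as All using (All; [])
open import Data.List.Relation.Unary.AllPairs using ([]; _∷_)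
open import Data.List.Relation.Unary.Any using (here)
open import Data.List.Relation.Unary.Linked using (Linked; linked?)
open import Data.List.Relation.Unary.Unique.Propositional using (Unique)
import Data.List.Relation.Unary.Unique.Propositional.Properties as Unique
open import Data.Product using (_×_; _,_)
open import Data.Sum using (_⊎_)
open import Data.Vec as Vec using (Vec; lookup; removeAt; updateAt; _[_]≔_)
open import Function using (_⇔_; mk⇔; module Equivalence)
import Level
open import Relation.Binary.PropositionalEquality using (_≡_; refl; cong; cong₂)
open import Relation.Nullary using (yes; no)
open import Relation.Nullary.Decidable using (_×-dec_; _⊎-dec_; map′)
open import Relation.Unary using (Pred; Decidable)

private variable
  n : ℕ

-- The ground set {1,…,n} is Fin n, so p ∈ {1,…,n} is represented by p - 1;
-- only the order of the ground set matters.

Block : ℕ → Set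
Block n = List⁺ (Fin n)

maxB minB : Block n → ℕ
maxB B = List⁺.foldr₁ _⊔_ (List⁺.map toℕ B)
minB B = List⁺.foldr₁ _⊓_ (List⁺.map toℕ B)

occurrences : Fin n → List (Block n) → ℕ
occurrences p π = List.length (filter (p Fin.≟_) (List.concat (List.map List⁺.toList π)))

record IsNCCrossing {n : ℕ} (π : List (Block n)) : Set where
  constructor isNCCrossing
  field
    increasing  : All (λ B → Linked Fin._<_ (List⁺.toList B)) π
    exactlyOnce : ∀ p → occurrences p π ≡ 1
    crossing    : Linked (λ B C → maxB B > minB C) π

isNCCrossing? : Decidable (IsNCCrossing {n})
isNCCrossing? π = map′
  (λ { (a , b , c) → isNCCrossing a b c })
  (λ { (isNCCrossing a b c) → a , b , c })
  (All.all? (λ B → linked? Fin._<?_ (List⁺.toList B)) π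
    ×-dec Fin.all? (λ p → occurrences p π ℕ.≟ 1)
    ×-dec linked? (λ B C → minB C <? maxB B) π)

type : List (Block n) → List ℕ
type = List.map List⁺.length

-- blockSeqs n s lists, without repetition, all sequences of blocks of type s
-- with entries in Fin n (see ∈-blockSeqs and blockSeqs-unique).

words : ∀ n → ℕ → List (List (Fin n))
words n zero    = [ [] ]
words n (suc k) = cartesianProductWith _∷_ (allFin n) (words n k)

blocks : ∀ n → ℕ → List (Block n)
blocks n zero    = []
blocks n (suc k) = cartesianProductWith _∷_ (allFin n) (words n k)

blockSeqs : ∀ n → List ℕ → List (List (Block n))
blockSeqs n []      = [ [] ]
blockSeqs n (k ∷ s) = cartesianProductWith _∷_ (blocks n k) (blockSeqs n s)

ncCrossings : (s : List ℕ) → List (List (Block (sum s)))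
ncCrossings s = filter isNCCrossing? (blockSeqs (sum s) s)

T : List ℕ → ℕ
T s = List.length (ncCrossings s)

∈-words⁺ : (w : List (Fin n)) → w ∈ words n (List.length w)
∈-words⁺ []      = here refl
∈-words⁺ (x ∷ w) = ∈-cartesianProductWith⁺ _∷_ (∈-allFin x) (∈-words⁺ w)

∈-words⁻ : ∀ k {w : List (Fin n)} → w ∈ words n k → List.length w ≡ k
∈-words⁻ zero    (here refl) = refl
∈-words⁻ {n} (suc k) w∈ with ∈-cartesianProductWith⁻ _∷_ (allFin n) (words n k) w∈
... | _ , _ , _ , v∈ , refl = cong suc (∈-words⁻ k v∈)

∈-blockSeqs⁺ : (π : List (Block n)) → π ∈ blockSeqs n (type π)
∈-blockSeqs⁺ []            = here refl
∈-blockSeqs⁺ ((x ∷ w) ∷ π) = ∈-cartesianProductWith⁺ _∷_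
  (∈-cartesianProductWith⁺ _∷_ (∈-allFin x) (∈-words⁺ w)) (∈-blockSeqs⁺ π)

∈-blocks⁻ : ∀ k {B : Block n} → B ∈ blocks n k → List⁺.length B ≡ k
∈-blocks⁻ {n} (suc k) B∈ with ∈-cartesianProductWith⁻ _∷_ (allFin n) (words n k) B∈
... | _ , _ , _ , w∈ , refl = cong suc (∈-words⁻ k w∈)

∈-blockSeqs⁻ : ∀ s {π : List (Block n)} → π ∈ blockSeqs n s → type π ≡ s
∈-blockSeqs⁻ []      (here refl) = refl
∈-blockSeqs⁻ {n} (k ∷ s) π∈ with ∈-cartesianProductWith⁻ _∷_ (blocks n k) (blockSeqs n s) π∈
... | _ , _ , B∈ , ρ∈ , refl = cong₂ _∷_ (∈-blocks⁻ k B∈) (∈-blockSeqs⁻ s ρ∈)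

∈-blockSeqs : ∀ s {π : List (Block n)} → π ∈ blockSeqs n s ⇔ type π ≡ s
∈-blockSeqs s {π} = mk⇔ (∈-blockSeqs⁻ s) (λ { refl → ∈-blockSeqs⁺ π })

words-unique : ∀ n k → Unique (words n k)
words-unique n zero    = [] ∷ []
words-unique n (suc k) =
  Unique.cartesianProductWith⁺ _∷_ List.∷-injective (Unique.allFin⁺ n) (words-unique n k)

blocks-unique : ∀ n k → Unique (blocks n k)
blocks-unique n zero    = []
blocks-unique n (suc k) =
  Unique.cartesianProductWith⁺ _∷_ (λ { refl → refl , refl }) (Unique.allFin⁺ n) (words-unique n k)

blockSeqs-unique : ∀ n s → Unique (blockSeqs n s)
blockSeqs-unique n []      = [] ∷ []
blockSeqs-unique n (k ∷ s) =
  Unique.cartesianProductWith⁺ _∷_ List.∷-injective (blocks-unique n k) (blockSeqs-unique n s)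

-- Together these say that T s is the number of noncommutative crossing
-- partitions of type s.

∈-ncCrossings : ∀ s {π} → π ∈ ncCrossings s ⇔ (type π ≡ s × IsNCCrossing π)
∈-ncCrossings s = mk⇔
  (λ π∈ → let π∈′ , c = ∈-filter⁻ isNCCrossing? {xs = blockSeqs (sum s) s} π∈
          in ∈-blockSeqs⁻ s π∈′ , c)
  (λ { (t , c) → ∈-filter⁺ isNCCrossing? (Equivalence.from (∈-blockSeqs s) t) c })

ncCrossings-unique : ∀ s → Unique (ncCrossings s)
ncCrossings-unique s = Unique.filter⁺ isNCCrossing? (blockSeqs-unique (sum s) s)

-- Index sets for s = (s₁,…,s_l) with l = suc m. Position i is the element
-- i - 1 of Fin (suc m), the position l is fromℕ m, and i ≤ l - 1 ranges over
-- Fin m with s_i = lookup s (inject₁ i) and s_{i+1} = lookup s (suc i).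

S₁ : ∀ {m} → Vec ℕ (suc m) → Pred (Fin (suc m)) _
S₁ {m} s i = (toℕ i < m × lookup s i > 1) ⊎ i ≡ fromℕ m

S₁? : ∀ {m} (s : Vec ℕ (suc m)) → Decidable (S₁ s)
S₁? {m} s i = (toℕ i <? m ×-dec 1 <? lookup s i) ⊎-dec i Fin.≟ fromℕ m

S₂ : ∀ {m} → Vec ℕ (suc m) → Pred (Fin m) _
S₂ s i = 2 ≤ lookup s (suc i)

S₂? : ∀ {m} (s : Vec ℕ (suc m)) → Decidable (S₂ s)
S₂? s i = 2 ≤? lookup s (suc i)

sumOver : {P : Pred (Fin n) Level.zero} → Decidable P → (Fin n → ℕ) → ℕ
sumOver {n} P? f = sum (List.map f (filter P? (allFin n)))

-- (s₁,…,s_i - 1,…,s_l), with the entry deleted if it becomes 0. For positive s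
-- and i ∈ S₁ s the deletion only happens at i = l.
decrement : ∀ {m} → Vec ℕ (suc m) → Fin (suc m) → List ℕ
decrement s i with lookup s i ℕ.≟ 1
... | yes _ = Vec.toList (removeAt s i)
... | no  _ = Vec.toList (updateAt s i pred)

-- (s₁,…,s_{i-1}, s_i + s_{i+1} - 1, s_{i+2},…,s_l)
merge : ∀ {m} → Vec ℕ (suc m) → Fin m → List ℕ
merge s i = Vec.toList
  (removeAt (s [ inject₁ i ]≔ (lookup s (inject₁ i) + lookup s (suc i) ∸ 1)) (suc i))

module Submission where

-- Remove the smallest element 0 from a crossing partition π. If the block
-- that contained it disappears (it must be the last one) or still crosses its
-- predecessor, the result is a crossing partition of type decrement s i.
-- Otherwise every element of the predecessor lies below the shrunken block,
-- so concatenating the two gives an increasing block and a crossing partition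
-- of type merge s i. Both operations are invertible: 0 may be added to any
-- block, since it crosses every predecessor and does not change a maximum.

open import Defs
open import Data.Fin as Fin using (Fin; zero; suc; toℕ)
import Data.Fin.Properties as Fin
open import Data.List as List using (List; []; _∷_; _++_; map; length; filter; allFin)
import Data.List.Properties as List
open import Data.List.Membership.Propositional using (_∈_)
open import Data.List.Membership.Propositional.Properties
  using (∈-lookup; ∈-allFin; ∈-filter⁺; ∈-filter⁻; ∈-map⁺; ∈-map⁻; ∈-++⁺ˡ; ∈-++⁺ʳ; ∈-++⁻)
import Data.List.Membership.Setoid.Properties as Membershipₛ
open import Data.List.NonEmpty as List⁺ using (List⁺; _∷_; _⁺++⁺_; _∷⁺_)
open import Data.List.Relation.Unary.All as LAll using ([]; _∷_)
import Data.List.Relation.Unary.All.Properties as LAll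
open import Data.List.Relation.Unary.AllPairs using ([]; _∷_)
open import Data.List.Relation.Unary.Any using (index; here; there)
open import Data.List.Relation.Unary.Linked as Linked using (Linked; []; [-]; _∷_; _∷′_; head′)
import Data.List.Relation.Unary.Linked.Properties as Linked
open import Data.List.Relation.Unary.Unique.Propositional using (Unique)
import Data.List.Relation.Unary.Unique.Propositional.Properties as Unique
open import Data.Maybe using (just)
open import Data.Maybe.Relation.Binary.Connected using (Connected; just)
open import Data.Nat using (ℕ; zero; suc; _+_; _∸_; _⊔_; _⊓_; _≤_; _<_; _>_; z≤n; s≤s; _<?_)
open import Data.Nat.ListAction using (sum)
open import Data.Nat.ListAction.Properties using (sum-++)
import Data.Nat.Properties as ℕ
open import Data.Product using (∃-syntax; _×_; _,_; proj₁; proj₂)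
open import Data.Sum using (_⊎_; inj₁; inj₂; [_,_]′)
import Data.Sum.Properties as Sum
open import Data.Vec as Vec using (Vec; []; _∷_; toList; lookup)
open import Data.Vec.Relation.Unary.All using (All; []; _∷_)
open import Function using (_∘_)
open import Relation.Binary.PropositionalEquality
  using (_≡_; _≢_; refl; sym; trans; cong; cong₂; subst; setoid; module ≡-Reasoning)
open import Relation.Nullary using (yes; no; contradiction; ¬_)

private variable
  m n i j : ℕ
  A I J : Set

-- Comparing lists

lookup-injective : {xs : List A} → Unique xs → ∀ {i j} → List.lookup xs i ≡ List.lookup xs j → i ≡ j
lookup-injective (_  ∷ _) {zero}  {zero}  _  = refl
lookup-injective (x∉ ∷ _) {zero}  {suc j} eq = contradiction eq (LAll.lookup x∉ (∈-lookup j))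
lookup-injective (x∉ ∷ _) {suc i} {zero}  eq = contradiction (sym eq) (LAll.lookup x∉ (∈-lookup i))
lookup-injective (_  ∷ u) {suc i} {suc j} eq = cong suc (lookup-injective u eq)

-- Picking an `R`-related entry of `ys` for each position of `xs` gives an injection between the
-- index sets. Since `R` is only a relation, one relation can serve for both inequalities of a
-- bijective count, with no inverse functions to define.
length-≤ : {xs : List I} {ys : List J} → Unique xs → (R : I → J → Set) →
  (∀ {x} → x ∈ xs → ∃[ y ] (y ∈ ys × R x y)) →
  (∀ {x x′ y} → x ∈ xs → x′ ∈ xs → R x y → R x′ y → x ≡ x′) →
  length xs ≤ length ys
length-≤ {J = J} {xs} {ys} unique R total injective = Fin.injective⇒≤ f-injective
  where
  image : ∀ i → ∃[ y ] (y ∈ ys × R (List.lookup xs i) y)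
  image i = total (∈-lookup i)

  f : Fin (length xs) → Fin (length ys)
  f i = index (proj₁ (proj₂ (image i)))

  f-injective : ∀ {i j} → f i ≡ f j → i ≡ j
  f-injective {i} {j} eq with image i | image j
  ... | y , y∈ , Ry | z , z∈ , Rz with Membershipₛ.index-injective (setoid J) y∈ z∈ eq
  ... | refl = lookup-injective unique (injective (∈-lookup i) (∈-lookup j) Ry Rz)

-- A disjoint union: the tag keeps apart equal elements coming from different indices, so the length
-- is the full sum.
tagged : (I → List A) → List I → List (I × A)
tagged f []       = []
tagged f (i ∷ is) = map (i ,_) (f i) ++ tagged f is

length-tagged : (f : I → List A) (is : List I) → length (tagged f is) ≡ sum (map (length ∘ f) is)
length-tagged f []       = refl
length-tagged f (i ∷ is) = trans (List.length-++ (map (i ,_) (f i)))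
  (cong₂ _+_ (List.length-map (i ,_) (f i)) (length-tagged f is))

∈-tagged⁺ : (f : I → List A) {is : List I} → ∀ {i a} → i ∈ is → a ∈ f i → (i , a) ∈ tagged f is
∈-tagged⁺ f (here refl)         a∈ = ∈-++⁺ˡ (∈-map⁺ _ a∈)
∈-tagged⁺ f {j ∷ is} (there i∈) a∈ = ∈-++⁺ʳ (map (j ,_) (f j)) (∈-tagged⁺ f i∈ a∈)

∈-tagged⁻ : (f : I → List A) (is : List I) → ∀ {i a} → (i , a) ∈ tagged f is → i ∈ is × a ∈ f i
∈-tagged⁻ f (j ∷ is) ia∈ with ∈-++⁻ (map (j ,_) (f j)) ia∈
... | inj₁ ia∈ˡ with ∈-map⁻ (j ,_) ia∈ˡ
...   | _ , a∈ , refl = here refl , a∈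
∈-tagged⁻ f (j ∷ is) ia∈ | inj₂ ia∈ʳ = let i∈ , a∈ = ∈-tagged⁻ f is ia∈ʳ in there i∈ , a∈

tagged-unique : (f : I → List A) {is : List I} → Unique is → (∀ i → Unique (f i)) → Unique (tagged f is)
tagged-unique f []                 _ = []
tagged-unique f {i ∷ is} (i∉ ∷ is!) u = Unique.++⁺
  (Unique.map⁺ (λ { refl → refl }) (u i)) (tagged-unique f is! u)
  λ (∈ˡ , ∈ʳ) → let _ , _ , eq = ∈-map⁻ (i ,_) ∈ˡ in
    LAll.lookup i∉ (proj₁ (∈-tagged⁻ f is ∈ʳ)) (sym (cong proj₁ eq))

split-length : (xs : List A) → ∀ k {l} → length xs ≡ k + suc l →
  ∃[ ys ] ∃[ z ] ∃[ zs ] (xs ≡ ys ++ z ∷ zs × length ys ≡ k × length zs ≡ l)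
split-length (x ∷ xs) zero    refl = [] , x , xs , refl , refl , refl
split-length (x ∷ xs) (suc k) eq with split-length xs k (ℕ.suc-injective eq)
... | ys , z , zs , refl , refl , refl = x ∷ ys , z , zs , refl , refl , refl

++-injective : (ws xs : List A) {ys zs : List A} → length ws ≡ length xs →
  ws ++ ys ≡ xs ++ zs → ws ≡ xs × ys ≡ zs
++-injective []       []       _  eq   = refl , eq
++-injective (w ∷ ws) (x ∷ xs) l  eq with List.∷-injective eq
... | refl , eq′ with ++-injective ws xs (ℕ.suc-injective l) eq′
... | refl , eq″ = refl , eq″

⁺++⁺-injective : (B C : List⁺ A) {D E : List⁺ A} → List⁺.length B ≡ List⁺.length C →
  B ⁺++⁺ D ≡ C ⁺++⁺ E → B ≡ C × D ≡ E
⁺++⁺-injective (b ∷ bs) (c ∷ cs) l eq with cong List⁺.head eq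
... | refl with ++-injective bs cs (ℕ.suc-injective l) (cong List⁺.tail eq)
... | refl , refl = refl , refl

-- Occurrences

count : Fin n → List (Fin n) → ℕ
count p xs = length (filter (p Fin.≟_) xs)

count-++ : (p : Fin n) (xs ys : List (Fin n)) → count p (xs ++ ys) ≡ count p xs + count p ys
count-++ p xs ys = trans (cong length (List.filter-++ (p Fin.≟_) xs ys)) (List.length-++ (filter (p Fin.≟_) xs))

count-∷ : (p : Fin n) (xs : List (Fin n)) → 1 ≤ count p (p ∷ xs)
count-∷ p xs = subst (1 ≤_) (sym (cong length (List.filter-accept (p Fin.≟_) refl))) (s≤s z≤n)

count-suc : (p : Fin n) (xs : List (Fin n)) → count (suc p) (map suc xs) ≡ count p xs
count-suc p []       = refl
count-suc p (x ∷ xs) with p Fin.≟ x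
... | yes _ = cong suc (count-suc p xs)
... | no  _ = count-suc p xs

count-zero : (xs : List (Fin n)) → count zero (map suc xs) ≡ 0
count-zero []       = refl
count-zero (x ∷ xs) = count-zero xs

occurrences-∷ : (p : Fin n) (B : Block n) (π : List (Block n)) →
  occurrences p (B ∷ π) ≡ count p (List⁺.toList B) + occurrences p π
occurrences-∷ p B π = count-++ p (List⁺.toList B) _

↑_ : Block n → Block (suc n)
↑_ = List⁺.map suc

infix 8 ↑_

↑-injective : {B C : Block n} → ↑ B ≡ ↑ C → B ≡ C
↑-injective {B = _ ∷ _} {C = _ ∷ _} eq = cong₂ _∷_ (Fin.suc-injective (cong List⁺.head eq))
  (List.map-injective Fin.suc-injective (cong List⁺.tail eq))

occurrences-suc : (p : Fin n) (π : List (Block n)) → occurrences (suc p) (map ↑_ π) ≡ occurrences p π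
occurrences-suc p []      = refl
occurrences-suc p (B ∷ π) = begin
  occurrences (suc p) (↑ B ∷ map ↑_ π)
    ≡⟨ occurrences-∷ (suc p) (↑ B) (map ↑_ π) ⟩
  count (suc p) (List⁺.toList (↑ B)) + occurrences (suc p) (map ↑_ π)
    ≡⟨ cong₂ _+_ (count-suc p (List⁺.toList B)) (occurrences-suc p π) ⟩
  count p (List⁺.toList B) + occurrences p π
    ≡⟨ occurrences-∷ p B π ⟨
  occurrences p (B ∷ π)
    ∎
  where open ≡-Reasoning

occurrences-zero-∷ : (B : Block n) (π : List (Block (suc n))) →
  occurrences zero (↑ B ∷ π) ≡ occurrences zero π
occurrences-zero-∷ B π = trans (occurrences-∷ zero (↑ B) π)
  (cong (_+ occurrences zero π) (count-zero (List⁺.toList B)))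

occurrences-zero : (π : List (Block n)) → occurrences zero (map ↑_ π) ≡ 0
occurrences-zero []      = refl
occurrences-zero (B ∷ π) = trans (occurrences-zero-∷ B (map ↑_ π)) (occurrences-zero π)

-- Blocks

Increasing : Block n → Set
Increasing B = Linked Fin._<_ (List⁺.toList B)

Crosses : Block n → Block n → Set
Crosses B C = maxB B > minB C

increasing-↑⁺ : (B : Block n) → Increasing B → Increasing (↑ B)
increasing-↑⁺ B inc = Linked.map⁺ (Linked.map s≤s inc)

increasing-↑⁻ : (B : Block n) → Increasing (↑ B) → Increasing B
increasing-↑⁻ B inc = Linked.map ℕ.≤-pred (Linked.map⁻ inc)

increasing-zero : (B : Block n) → Increasing B → Increasing (zero ∷⁺ ↑ B)
increasing-zero B inc = s≤s z≤n ∷ increasing-↑⁺ B inc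

-- Entries after the first exceed another entry, so none of them is 0.
increasing-tail : (x : Fin (suc n)) (xs : List (Fin (suc n))) → Increasing (x ∷ xs) → ∃[ ys ] xs ≡ map suc ys
increasing-tail x []           _          = [] , refl
increasing-tail x (suc y ∷ xs) (_ ∷ inc) with increasing-tail (suc y) xs inc
... | ys , refl = y ∷ ys , refl

max-↑ : (B : Block n) → maxB (↑ B) ≡ suc (maxB B)
max-↑ (x ∷ xs) = go x xs
  where
  go : (x : Fin n) (xs : List (Fin n)) → maxB (↑ (x ∷ xs)) ≡ suc (maxB (x ∷ xs))
  go x []       = refl
  go x (y ∷ ys) = cong (suc (toℕ x) ⊔_) (go y ys)

min-↑ : (B : Block n) → minB (↑ B) ≡ suc (minB B)
min-↑ (x ∷ xs) = go x xs
  where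
  go : (x : Fin n) (xs : List (Fin n)) → minB (↑ (x ∷ xs)) ≡ suc (minB (x ∷ xs))
  go x []       = refl
  go x (y ∷ ys) = cong (suc (toℕ x) ⊓_) (go y ys)

min-increasing : (B : Block n) → Increasing B → minB B ≡ toℕ (List⁺.head B)
min-increasing (x ∷ xs) = go x xs
  where
  go : (x : Fin n) (xs : List (Fin n)) → Increasing (x ∷ xs) → minB (x ∷ xs) ≡ toℕ x
  go x []       _          = refl
  go x (y ∷ ys) (x<y ∷ inc) = trans (cong (toℕ x ⊓_) (go y ys inc)) (ℕ.m≤n⇒m⊓n≡m (ℕ.<⇒≤ x<y))

head≤max : (B : Block n) → toℕ (List⁺.head B) ≤ maxB B
head≤max (x ∷ [])     = ℕ.≤-refl
head≤max (x ∷ y ∷ ys) = ℕ.m≤m⊔n (toℕ x) (maxB (y ∷ ys))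

max-⁺++⁺ : (B C : Block n) → maxB (B ⁺++⁺ C) ≡ maxB B ⊔ maxB C
max-⁺++⁺ (x ∷ xs) C = go x xs
  where
  go : ∀ x xs → maxB ((x ∷ xs) ⁺++⁺ C) ≡ maxB (x ∷ xs) ⊔ maxB C
  go x []       = refl
  go x (y ∷ ys) = trans (cong (toℕ x ⊔_) (go y ys)) (sym (ℕ.⊔-assoc (toℕ x) (maxB (y ∷ ys)) (maxB C)))

-- The only new link is the one where the blocks meet; there the last entry of `B` is compared with
-- the head of `C`, which is `minB C`.
increasing-⁺++⁺⁺ : (B C : Block n) → Increasing B → Increasing C → maxB B < minB C → Increasing (B ⁺++⁺ C)
increasing-⁺++⁺⁺ (x ∷ xs) C incB incC = go x xs incB
  where
  go : ∀ x xs → Increasing (x ∷ xs) → maxB (x ∷ xs) < minB C → Increasing ((x ∷ xs) ⁺++⁺ C)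
  go x []       _           x<C = subst (toℕ x <_) (min-increasing C incC) x<C ∷ incC
  go x (y ∷ ys) (x<y ∷ inc) B<C = x<y ∷ go y ys inc (ℕ.≤-<-trans (ℕ.m≤n⊔m (toℕ x) (maxB (y ∷ ys))) B<C)

increasing-⁺++⁺⁻ : (B C : Block n) → Increasing (B ⁺++⁺ C) → Increasing B × Increasing C × maxB B < minB C
increasing-⁺++⁺⁻ (x ∷ xs) C = go x xs
  where
  go : ∀ x xs → Increasing ((x ∷ xs) ⁺++⁺ C) → Increasing (x ∷ xs) × Increasing C × maxB (x ∷ xs) < minB C
  go x []       (x<c ∷ inc) = [-] , inc , subst (toℕ x <_) (sym (min-increasing C inc)) x<c
  go x (y ∷ ys) (x<y ∷ inc) with go y ys inc
  ... | incB , incC , B<C = x<y ∷ incB , incC , ℕ.⊔-lub (ℕ.<-trans (ℕ.<-≤-trans x<y (head≤max (y ∷ ys))) B<C) B<C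

min-⁺++⁺ : (B C : Block n) → Increasing (B ⁺++⁺ C) → minB (B ⁺++⁺ C) ≡ minB B
min-⁺++⁺ B C inc = trans (min-increasing (B ⁺++⁺ C) inc)
  (sym (min-increasing B (proj₁ (increasing-⁺++⁺⁻ B C inc))))

max-increasing-⁺++⁺ : (B C : Block n) → Increasing (B ⁺++⁺ C) → maxB (B ⁺++⁺ C) ≡ maxB C
max-increasing-⁺++⁺ B C inc with increasing-⁺++⁺⁻ B C inc
... | _ , incC , B<C = trans (max-⁺++⁺ B C) (ℕ.m≤n⇒m⊔n≡n (ℕ.≤-trans (ℕ.<⇒≤ B<C)
  (subst (_≤ maxB C) (sym (min-increasing C incC)) (head≤max C))))

max-occurs : (p : Fin n) (B : Block n) → toℕ p ≡ maxB B → 1 ≤ count p (List⁺.toList B)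
max-occurs p (x ∷ xs) = go x xs
  where
  first : ∀ x xs → toℕ p ≡ toℕ x → 1 ≤ count p (x ∷ xs)
  first x xs eq = subst (λ z → 1 ≤ count p (z ∷ xs)) (Fin.toℕ-injective eq) (count-∷ p xs)

  go : ∀ x xs → toℕ p ≡ maxB (x ∷ xs) → 1 ≤ count p (x ∷ xs)
  go x []       eq = first x [] eq
  go x (y ∷ ys) eq with ℕ.⊔-sel (toℕ x) (maxB (y ∷ ys))
  ... | inj₁ max≡x = first x (y ∷ ys) (trans eq max≡x)
  ... | inj₂ max≡y = subst (1 ≤_) (sym (count-++ p (x ∷ []) (y ∷ ys)))
    (ℕ.≤-trans (go y ys (trans eq max≡y)) (ℕ.m≤n+m (count p (y ∷ ys)) (count p (x ∷ []))))

-- A common value would be counted once in `B` and again as the head of `C`. This makes the failure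
-- of crossing a strict inequality, as concatenation requires.
max≢min : (B C : Block n) (π : List (Block n)) → Increasing C →
  (∀ p → occurrences p (B ∷ C ∷ π) ≤ 1) → maxB B ≢ minB C
max≢min B C π incC once eq = ℕ.<-irrefl refl (ℕ.≤-trans twice (once p))
  where
  p : Fin _
  p = List⁺.head C

  twice : 2 ≤ occurrences p (B ∷ C ∷ π)
  twice = subst (2 ≤_)
    (sym (trans (occurrences-∷ p B (C ∷ π)) (cong (count p (List⁺.toList B) +_) (occurrences-∷ p C π))))
    (ℕ.+-mono-≤ (max-occurs p B (sym (trans eq (min-increasing C incC))))
      (ℕ.≤-trans (count-∷ p (List⁺.tail C)) (ℕ.m≤m+n _ (occurrences p π))))

crosses-zero : (B : Block n) (xs : List (Fin (suc n))) → Crosses (↑ B) (zero ∷ xs)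
crosses-zero B xs = subst (minB (zero ∷ xs) <_) (sym (max-↑ B)) (s≤s (min≡0 xs))
  where
  min≡0 : ∀ xs → minB (zero ∷ xs) ≤ maxB B
  min≡0 []       = z≤n
  min≡0 (_ ∷ _) = z≤n

crosses-↑⁺ : {B C : Block n} → Crosses B C → Crosses (↑ B) (↑ C)
crosses-↑⁺ {B = B} {C} c rewrite max-↑ B | min-↑ C = s≤s c

crosses-↑⁻ : {B C : Block n} → Crosses (↑ B) (↑ C) → Crosses B C
crosses-↑⁻ {B = B} {C} c rewrite max-↑ B | min-↑ C = ℕ.≤-pred c

-- Sequences of blocks

linked-↑⁺ : {σ : List (Block n)} → Linked Crosses σ → Linked Crosses (map ↑_ σ)
linked-↑⁺ = Linked.map⁺ ∘ Linked.map (λ {B} {C} → crosses-↑⁺ {B = B} {C})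

linked-↑⁻ : {σ : List (Block n)} → Linked Crosses (map ↑_ σ) → Linked Crosses σ
linked-↑⁻ = Linked.map (λ {B} {C} → crosses-↑⁻ {B = B} {C}) ∘ Linked.map⁻

-- The first block enters the crossing chain only through its maximum. Prepending 0 to it, or
-- concatenating a lower block in front of it, therefore leaves the chain intact.
linked-cong : {B C : Block n} {σ : List (Block n)} → maxB B ≡ maxB C →
  Linked Crosses (B ∷ σ) → Linked Crosses (C ∷ σ)
linked-cong eq [-]       = [-]
linked-cong eq (c ∷ cs) = subst (_ <_) eq c ∷ cs

length-↑ : (B : Block n) → List⁺.length (↑ B) ≡ List⁺.length B
length-↑ B = cong suc (List.length-map suc (List⁺.tail B))

type-↑ : (σ : List (Block n)) → type (map ↑_ σ) ≡ type σ
type-↑ []      = refl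
type-↑ (B ∷ σ) = cong₂ _∷_ (length-↑ B) (type-↑ σ)

lower-all : (π : List (Block (suc n))) → LAll.All Increasing π → occurrences zero π ≡ 0 → ∃[ σ ] π ≡ map ↑_ σ
lower-all []                 _             _  = [] , refl
-- A first block starting with `zero` would make the occurrence count a successor.
lower-all ((suc x ∷ xs) ∷ π) (inc ∷ incs) eq with increasing-tail (suc x) xs inc
... | ys , refl with lower-all π incs (trans (sym (occurrences-zero-∷ (x ∷ ys) π)) eq)
... | σ , refl = (x ∷ ys) ∷ σ , refl

-- Inserting a new smallest element

data Kind : Set where
  add cut : Kind

private variable
  k k′ : Kind

-- Step k i s σ π: π has type s, and removing 0 from it gives σ; i is the
-- index in the sum (from 0) of the term counting σ, in the first sum for add
-- and in the second sum for cut.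

data Step {n} : Kind → ℕ → Vec ℕ (suc m) → List (Block n) → List (Block (suc n)) → Set where
  new   : Step add 0 (1 ∷ []) [] ((zero ∷ []) ∷ [])
  grow  : ∀ B {σ} {s : Vec ℕ m} → type σ ≡ toList s →
    Step add 0 (suc (List⁺.length B) ∷ s) (B ∷ σ) ((zero ∷⁺ ↑ B) ∷ map ↑_ σ)
  split : ∀ B C {σ} {s : Vec ℕ m} → type σ ≡ toList s →
    Step cut 0 (List⁺.length B ∷ suc (List⁺.length C) ∷ s) ((B ⁺++⁺ C) ∷ σ) (↑ B ∷ (zero ∷⁺ ↑ C) ∷ map ↑_ σ)
  skip  : ∀ B {σ π} {s : Vec ℕ (suc m)} → Step k i s σ π →
    Step k (suc i) (List⁺.length B ∷ s) (B ∷ σ) (↑ B ∷ π)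

private variable
  s s′ : Vec ℕ (suc m)
  σ τ : List (Block n)
  π ρ : List (Block (suc n))

-- Insertion preserves crossing partitions

step-type : Step k i s σ π → type π ≡ toList s
step-type new                = refl
step-type (grow B {σ} eq)    = cong₂ _∷_ (cong suc (length-↑ B)) (trans (type-↑ σ) eq)
step-type (split B C {σ} eq) = cong₂ _∷_ (length-↑ B) (cong₂ _∷_ (cong suc (length-↑ C)) (trans (type-↑ σ) eq))
step-type (skip B st)        = cong₂ _∷_ (length-↑ B) (step-type st)

step-occurrences-zero : Step k i s σ π → occurrences zero π ≡ 1
step-occurrences-zero new                = refl
step-occurrences-zero (grow B {σ} _)     = cong suc (occurrences-zero (B ∷ σ))
step-occurrences-zero (split B C {σ} _)  =
  trans (occurrences-zero-∷ B ((zero ∷⁺ ↑ C) ∷ map ↑_ σ)) (cong suc (occurrences-zero (C ∷ σ)))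
step-occurrences-zero (skip B {π = π} st) = trans (occurrences-zero-∷ B π) (step-occurrences-zero st)

step-occurrences-suc : (p : Fin n) → Step k i s σ π → occurrences (suc p) π ≡ occurrences p σ
step-occurrences-suc p new               = refl
step-occurrences-suc p (grow B {σ} _)    = occurrences-suc p (B ∷ σ)
step-occurrences-suc p (split B C {σ} _) = begin
  occurrences (suc p) (↑ B ∷ (zero ∷⁺ ↑ C) ∷ map ↑_ σ)
    ≡⟨ occurrences-∷ (suc p) (↑ B) ((zero ∷⁺ ↑ C) ∷ map ↑_ σ) ⟩
  -- The inserted `zero` drops out by computation, as it differs from `suc p`.
  count (suc p) (List⁺.toList (↑ B)) + occurrences (suc p) (↑ C ∷ map ↑_ σ)
    ≡⟨ occurrences-∷ (suc p) (↑ B) (↑ C ∷ map ↑_ σ) ⟨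
  occurrences (suc p) (↑ B ∷ ↑ C ∷ map ↑_ σ)
    ≡⟨ occurrences-suc p (B ∷ C ∷ σ) ⟩
  occurrences p (B ∷ C ∷ σ)
    ≡⟨ cong (count p) (List.++-assoc (List⁺.toList B) (List⁺.toList C) (List.concat (map List⁺.toList σ))) ⟨
  occurrences p ((B ⁺++⁺ C) ∷ σ)
    ∎
  where open ≡-Reasoning
step-occurrences-suc p (skip B {σ} {π} st) = begin
  occurrences (suc p) (↑ B ∷ π)
    ≡⟨ occurrences-∷ (suc p) (↑ B) π ⟩
  count (suc p) (List⁺.toList (↑ B)) + occurrences (suc p) π
    ≡⟨ cong₂ _+_ (count-suc p (List⁺.toList B)) (step-occurrences-suc p st) ⟩
  count p (List⁺.toList B) + occurrences p σ
    ≡⟨ occurrences-∷ p B σ ⟨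
  occurrences p (B ∷ σ)
    ∎
  where open ≡-Reasoning

increasing-all-↑⁺ : LAll.All Increasing σ → LAll.All Increasing (map ↑_ σ)
increasing-all-↑⁺ incs = LAll.map⁺ (LAll.map (λ {B} → increasing-↑⁺ B) incs)

increasing-all-↑⁻ : LAll.All Increasing (map ↑_ σ) → LAll.All Increasing σ
increasing-all-↑⁻ incs = LAll.map (λ {B} → increasing-↑⁻ B) (LAll.map⁻ incs)

step-increasing : Step k i s σ π → LAll.All Increasing σ → LAll.All Increasing π
step-increasing new           _            = [-] ∷ []
step-increasing (grow B _)    (inc ∷ incs) = increasing-zero B inc ∷ increasing-all-↑⁺ incs
step-increasing (split B C _) (inc ∷ incs) with increasing-⁺++⁺⁻ B C inc
... | incB , incC , _ = increasing-↑⁺ B incB ∷ increasing-zero C incC ∷ increasing-all-↑⁺ incs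
step-increasing (skip B st)   (inc ∷ incs) = increasing-↑⁺ B inc ∷ step-increasing st incs

-- If 0 goes into the first block, every shifted block crosses that block. Otherwise the minimum of
-- the first block is only shifted: a cut keeps the smaller part first, and that part has the
-- minimum of the concatenation.
step-connected : (B : Block n) → Step k i s σ π → LAll.All Increasing σ →
  Connected Crosses (just B) (List.head σ) → Connected Crosses (just (↑ B)) (List.head π)
step-connected B new           _         _        = just (crosses-zero B [])
step-connected B (grow C _)    _         _        = just (crosses-zero B (List⁺.toList (↑ C)))
step-connected B (split C D _) (inc ∷ _) (just c) =
  just (crosses-↑⁺ {B = B} {C} (subst (_< maxB B) (min-⁺++⁺ C D inc) c))
step-connected B (skip C _)    _         (just c) = just (crosses-↑⁺ {B = B} {C} c)

step-linked : Step k i s σ π → LAll.All Increasing σ → Linked Crosses σ → Linked Crosses π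
step-linked new           _            _  = [-]
step-linked (grow B _)    _            cs = linked-cong {B = ↑ B} {zero ∷⁺ ↑ B} refl (linked-↑⁺ cs)
step-linked (split B C _) (inc ∷ _)    cs = crosses-zero B (List⁺.toList (↑ C)) ∷
  linked-cong {B = ↑ C} {zero ∷⁺ ↑ C} refl (linked-↑⁺ (linked-cong (max-increasing-⁺++⁺ B C inc) cs))
step-linked (skip B st)   (_ ∷ incs)   cs =
  step-connected B st incs (head′ cs) ∷′ step-linked st incs (Linked.tail cs)

step-crossing : Step k i s σ π → IsNCCrossing σ → IsNCCrossing π
step-crossing {σ = σ} {π} st (isNCCrossing incs once cs) =
  isNCCrossing (step-increasing st incs) once′ (step-linked st incs cs)
  where
  once′ : ∀ p → occurrences p π ≡ 1
  once′ zero    = step-occurrences-zero st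
  once′ (suc p) = trans (step-occurrences-suc p st) (once p)

-- For an addition, `new` and `grow` are told apart by whether `σ` is empty. For a cut, the type
-- prescribes the length of the first part, hence the place of the cut.
step-functional : Step k i s σ π → Step k i s′ τ ρ → toList s ≡ toList s′ → σ ≡ τ → π ≡ ρ
step-functional new           new             _  _    = refl
step-functional (grow B _)    (grow .B _)     _  refl = refl
step-functional (split B C _) (split B′ C′ _) eq στ
  with ⁺++⁺-injective B B′ (List.∷-injectiveˡ eq) (List.∷-injectiveˡ στ) | List.∷-injectiveʳ στ
... | refl , refl | refl = refl
step-functional (skip B st)   (skip B′ st′)   eq στ =
  cong₂ _∷_ (cong ↑_ (List.∷-injectiveˡ στ)) (step-functional st st′ (List.∷-injectiveʳ eq) (List.∷-injectiveʳ στ))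

-- Injectivity of insertion

map-↑-injective : map ↑_ σ ≡ map ↑_ τ → σ ≡ τ
map-↑-injective = List.map-injective ↑-injective

-- The conditions of `IsNCCrossing` that pass to tails. `exactlyOnce` does not, so occurrences are
-- tracked separately.
Crossing : List (Block n) → Set
Crossing σ = LAll.All Increasing σ × Linked Crosses σ

crossing-tail : {B : Block n} → Crossing (B ∷ σ) → Crossing σ
crossing-tail (_ ∷ incs , cs) = incs , Linked.tail cs

-- An addition after B yields the same π as cutting B ⁺++⁺ C only if B and C
-- both cross and do not cross.
skip-grow≢split : (B C : Block n) → Crossing (B ∷ C ∷ σ) → ¬ Increasing (B ⁺++⁺ C)
skip-grow≢split B C (_ , c ∷ _) inc = ℕ.<-asym c (proj₂ (proj₂ (increasing-⁺++⁺⁻ B C inc)))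

-- The block containing 0, and whether 0 is alone in it, separates all pairs of constructors except
-- a cut and an addition to the second block; those are separated by the crossing condition.
step-injective : Step k i s σ π → Step k′ j s′ τ ρ → π ≡ ρ → Crossing σ → Crossing τ →
  k ≡ k′ × i ≡ j × σ ≡ τ
step-injective new new _ _ _ = refl , refl , refl
step-injective new (grow _ _) () _ _
step-injective new (split _ _ _) () _ _
step-injective new (skip _ _) () _ _
step-injective (grow _ _) new () _ _
step-injective (grow B _) (grow C _) eq _ _
  -- The function strips the leading `zero` from the first block; its default value `↑ B` is never
  -- reached.
  with ↑-injective {B = B} {C} (cong (λ { ((_ ∷ x ∷ xs) ∷ _) → x ∷ xs ; _ → ↑ B }) eq)
     | map-↑-injective (List.∷-injectiveʳ eq)
... | refl | refl = refl , refl , refl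
step-injective (grow _ _) (split _ _ _) () _ _
step-injective (grow _ _) (skip _ _) () _ _
step-injective (split _ _ _) new () _ _
step-injective (split _ _ _) (grow _ _) () _ _
step-injective (split B C _) (split D E _) eq _ _
  with ↑-injective {B = B} {D} (List.∷-injectiveˡ eq)
     | ↑-injective {B = C} {E} (cong (λ { (_ ∷ (_ ∷ x ∷ xs) ∷ _) → x ∷ xs ; _ → ↑ C }) eq)
     | map-↑-injective (List.∷-injectiveʳ (List.∷-injectiveʳ eq))
... | refl | refl | refl = refl , refl , refl
step-injective (split B C _) (skip D (grow E _)) eq (inc ∷ _ , _) cτ
  with ↑-injective {B = B} {D} (List.∷-injectiveˡ eq)
     | ↑-injective {B = C} {E} (cong (λ { (_ ∷ (_ ∷ x ∷ xs) ∷ _) → x ∷ xs ; _ → ↑ C }) eq)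
... | refl | refl = contradiction inc (skip-grow≢split B C cτ)
step-injective (split _ _ _) (skip _ new) () _ _
step-injective (split _ _ _) (skip _ (split _ _ _)) () _ _
step-injective (split _ _ _) (skip _ (skip _ _)) () _ _
step-injective (skip _ _) new () _ _
step-injective (skip _ _) (grow _ _) () _ _
step-injective (skip D (grow E _)) (split B C _) eq cσ (inc ∷ _ , _)
  with ↑-injective {B = B} {D} (sym (List.∷-injectiveˡ eq))
     | ↑-injective {B = C} {E} (cong (λ { (_ ∷ (_ ∷ x ∷ xs) ∷ _) → x ∷ xs ; _ → ↑ C }) (sym eq))
... | refl | refl = contradiction inc (skip-grow≢split B C cσ)
step-injective (skip _ new) (split _ _ _) () _ _
step-injective (skip _ (split _ _ _)) (split _ _ _) () _ _
step-injective (skip _ (skip _ _)) (split _ _ _) () _ _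
step-injective (skip B st) (skip C st′) eq cσ cτ
  with ↑-injective {B = B} {C} (List.∷-injectiveˡ eq)
     | step-injective st st′ (List.∷-injectiveʳ eq) (crossing-tail cσ) (crossing-tail cτ)
... | refl | refl , refl , refl = refl , refl , refl

-- Removing the smallest element

Lowering : Vec ℕ (suc m) → List (Block (suc n)) → Set
Lowering s π = ∃[ k ] ∃[ i ] ∃[ σ ] (Step k i s σ π × Crossing σ)

-- Prefixing `B` can change the kind of the step only if 0 was added to the block `C` just after
-- `B`: if `B` crosses `C` the step stays an addition, otherwise it becomes a cut of `B ⁺++⁺ C`. In
-- the other cases the link from `B` is inherited from `π`, or there is no link left.
lowering-skip : (B : Block n) → Increasing B → Step k i s σ π → Crossing σ →
  Connected Crosses (just (↑ B)) (List.head π) → (∀ p → occurrences p (B ∷ σ) ≤ 1) →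
  Lowering (List⁺.length B ∷ s) (↑ B ∷ π)
lowering-skip B inc new _ _ _ = _ , _ , _ , skip B new , inc ∷ [] , [-]
lowering-skip B inc (grow C {σ} eq) (incC ∷ incs , cs) _ once with minB C <? maxB B
... | yes c = _ , _ , _ , skip B (grow C eq) , inc ∷ incC ∷ incs , c ∷ cs
... | no ¬c = _ , _ , _ , split B C eq , incBC ∷ incs ,
  linked-cong (sym (max-increasing-⁺++⁺ B C incBC)) cs
  where
  incBC : Increasing (B ⁺++⁺ C)
  incBC = increasing-⁺++⁺⁺ B C inc incC (ℕ.≤∧≢⇒< (ℕ.≮⇒≥ ¬c) (max≢min B C σ incC once))
lowering-skip B inc (split C D eq) (incCD ∷ incs , cs) (just c) _ =
  _ , _ , _ , skip B (split C D eq) , inc ∷ incCD ∷ incs ,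
  subst (_< maxB B) (sym (min-⁺++⁺ C D incCD)) (crosses-↑⁻ {B = B} {C} c) ∷ cs
lowering-skip B inc (skip C st) (incs , cs) (just c) _ =
  _ , _ , _ , skip B (skip C st) , inc ∷ incs ,
  crosses-↑⁻ {B = B} {C} c ∷ cs

-- The hypotheses on occurrences are weaker than `exactlyOnce` so that induction can pass to tails,
-- from which elements other than 0 may be missing.
lowering : (s : Vec ℕ (suc m)) (π : List (Block (suc n))) → type π ≡ toList s → Crossing π →
  occurrences zero π ≡ 1 → (∀ p → occurrences p π ≤ 1) → Lowering s π
lowering (_ ∷ _) ((zero ∷ xs) ∷ π) eq (inc ∷ _ , _) _ _ with increasing-tail zero xs inc
lowering (_ ∷ []) ((zero ∷ _) ∷ []) refl _ _ _ | [] , refl = _ , _ , _ , new , [] , []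
-- The block of 0 alone has maximum 0, which exceeds no minimum, so it can only be last.
lowering (_ ∷ _) ((zero ∷ _) ∷ C ∷ π) _ (_ , () ∷ _) _ _ | [] , refl
lowering (_ ∷ s) ((zero ∷ _) ∷ π) eq (inc ∷ incs , cs) occ _ | y ∷ ys , refl
  with lower-all π incs (trans (sym (occurrences-zero-∷ (y ∷ ys) π)) (ℕ.suc-injective occ))
... | σ , refl with trans (sym (cong suc (length-↑ (y ∷ ys)))) (List.∷-injectiveˡ eq)
... | refl = _ , _ , _ , grow (y ∷ ys) (trans (sym (type-↑ σ)) (List.∷-injectiveʳ eq)) ,
  increasing-↑⁻ (y ∷ ys) (Linked.tail inc) ∷ increasing-all-↑⁻ incs ,
  linked-↑⁻ (linked-cong {B = zero ∷⁺ ↑ (y ∷ ys)} {↑ (y ∷ ys)} refl cs)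
lowering (_ ∷ _) ((suc x ∷ xs) ∷ π) _ (inc ∷ _ , _) _ _ with increasing-tail (suc x) xs inc
lowering (_ ∷ []) ((suc x ∷ _) ∷ []) _ _ occ _ | ys , refl
  with trans (sym (occurrences-zero-∷ (x ∷ ys) [])) occ
... | ()
lowering (_ ∷ s@(_ ∷ _)) ((suc x ∷ _) ∷ π) eq (inc ∷ incs , cs) occ once | ys , refl
  with lowering s π (List.∷-injectiveʳ eq) (incs , Linked.tail cs)
         (trans (sym (occurrences-zero-∷ (x ∷ ys) π)) occ)
         (λ p → ℕ.≤-trans
           (subst (occurrences p π ≤_) (sym (occurrences-∷ p (↑ (x ∷ ys)) π)) (ℕ.m≤n+m _ _))
           (once p))
     | trans (sym (length-↑ (x ∷ ys))) (List.∷-injectiveˡ eq)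
... | _ , _ , _ , st , cσ | refl =
  lowering-skip (x ∷ ys) (increasing-↑⁻ (x ∷ ys) inc) st cσ (head′ cs)
    -- `Step` makes no crossing claim, so `skip` already transfers occurrence counts here, before it
    -- is known whether the first block crosses the next.
    (λ p → subst (_≤ 1) (step-occurrences-suc p (skip (x ∷ ys) st)) (once (suc p)))

crossing : IsNCCrossing σ → Crossing σ
crossing (isNCCrossing incs _ cs) = incs , cs

lowering-crossing : (s : Vec ℕ (suc m)) (π : List (Block (suc n))) → type π ≡ toList s → IsNCCrossing π →
  ∃[ k ] ∃[ i ] ∃[ σ ] (Step k i s σ π × IsNCCrossing σ)
lowering-crossing s π eq c@(isNCCrossing _ once _)
  with lowering s π eq (crossing c) (once zero) (λ p → ℕ.≤-reflexive (once p))
... | k , i , σ , st , incs , cs = k , i , σ , st ,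
  isNCCrossing incs (λ p → trans (sym (step-occurrences-suc p st)) (once (suc p))) cs

-- The terms of the two sums

S₁-suc⁺ : ∀ a (s : Vec ℕ (suc m)) {i} → S₁ s i → S₁ (a ∷ s) (suc i)
S₁-suc⁺ _ _ (inj₁ (i<m , s>1)) = inj₁ (s≤s i<m , s>1)
S₁-suc⁺ _ _ (inj₂ refl)        = inj₂ refl

S₁-suc⁻ : ∀ a (s : Vec ℕ (suc m)) {i} → S₁ (a ∷ s) (suc i) → S₁ s i
S₁-suc⁻ _ _ (inj₁ (i<m , s>1)) = inj₁ (ℕ.≤-pred i<m , s>1)
S₁-suc⁻ _ _ (inj₂ refl)        = inj₂ refl

decrement-∷ : ∀ a (s : Vec ℕ (suc m)) i → decrement (a ∷ s) (suc i) ≡ a ∷ decrement s i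
decrement-∷ a s@(_ ∷ _) i with lookup s i ℕ.≟ 1
... | yes _ = refl
... | no  _ = refl

merge-∷ : ∀ a (s : Vec ℕ (suc m)) i → merge (a ∷ s) (suc i) ≡ a ∷ merge s i
merge-∷ a (_ ∷ _ ∷ _) zero    = refl
merge-∷ a (_ ∷ _ ∷ _) (suc i) = refl

add-index : (s : Vec ℕ (suc m)) → Step add i s σ π →
  ∃[ j ] (toℕ j ≡ i × S₁ s j × type σ ≡ decrement s j)
add-index (_ ∷ []) new         = zero , refl , inj₂ refl , refl
add-index (_ ∷ []) (grow B eq) = zero , refl , inj₂ refl , cong (_ ∷_) eq
-- Since `B` is nonempty, the block with 0 has at least two elements, as `S₁` demands before the
-- last position.
add-index (_ ∷ _ ∷ _) (grow B eq) = zero , refl , inj₁ (s≤s z≤n , s≤s (s≤s z≤n)) , cong (_ ∷_) eq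
add-index (a ∷ s) (skip B st) with add-index s st
... | j , refl , j∈ , eq = suc j , refl , S₁-suc⁺ a s j∈ , trans (cong (a ∷_) eq) (sym (decrement-∷ a s j))

length-⁺++⁺ : (B C : List⁺ A) → List⁺.length (B ⁺++⁺ C) ≡ List⁺.length B + List⁺.length C
length-⁺++⁺ (_ ∷ xs) C = cong suc (List.length-++ xs)

cut-index : (s : Vec ℕ (suc m)) → Step cut i s σ π →
  ∃[ j ] (toℕ j ≡ i × S₂ s j × type σ ≡ merge s j)
cut-index (_ ∷ _ ∷ _) (split B C eq) = zero , refl , s≤s (s≤s z≤n) ,
  -- The subtracted 1 accounts for the removed 0, counted in the second block.
  cong₂ _∷_ (trans (length-⁺++⁺ B C) (cong (_∸ 1) (sym (ℕ.+-suc (List⁺.length B) (List⁺.length C))))) eq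
cut-index (a ∷ s@(_ ∷ _)) (skip B st) with cut-index s st
... | j , refl , j∈ , eq = suc j , refl , j∈ , trans (cong (a ∷_) eq) (sym (merge-∷ a s j))

add-step : (s : Vec ℕ (suc m)) → All (_> 0) s → ∀ j → S₁ s j → (σ : List (Block n)) →
  type σ ≡ decrement s j → ∃[ π ] Step add (toℕ j) s σ π
add-step (1 ∷ []) _ zero _ [] _ = _ , new
-- An entry 1 before the last position is not in `S₁`.
add-step (1 ∷ _ ∷ _) _ zero (inj₁ (_ , s≤s ())) _ _
add-step (1 ∷ _ ∷ _) _ zero (inj₂ ()) _ _
add-step (suc (suc _) ∷ s) _ zero _ (B ∷ σ) eq with List.∷-injectiveˡ eq
... | refl = _ , grow B (List.∷-injectiveʳ eq)
add-step (a ∷ s@(_ ∷ _)) (_ ∷ pos) (suc j) j∈ σ eq with σ | trans eq (decrement-∷ a s j)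
... | B ∷ σ′ | eq′ with List.∷-injectiveˡ eq′ | add-step s pos j (S₁-suc⁻ a s j∈) σ′ (List.∷-injectiveʳ eq′)
... | refl | _ , st = _ , skip B st

cut-step : (s : Vec ℕ (suc m)) → All (_> 0) s → ∀ j → S₂ s j → (σ : List (Block n)) →
  type σ ≡ merge s j → ∃[ π ] Step cut (toℕ j) s σ π
cut-step (suc a ∷ suc (suc b) ∷ s) _ zero _ ((x ∷ xs) ∷ σ) eq
  -- The merged block has `suc a + suc b` elements. With `x` set aside, `a` more complete the first
  -- part; the remaining `suc b` form the second part, to which 0 is added.
  with split-length xs a (ℕ.suc-injective (trans (List.∷-injectiveˡ eq) (ℕ.+-suc a (suc b))))
... | ys , z , zs , refl , refl , refl = _ , split (x ∷ ys) (z ∷ zs) (List.∷-injectiveʳ eq)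
cut-step (suc a ∷ suc zero ∷ s) _ zero (s≤s ()) _ _
cut-step (a ∷ s@(_ ∷ _)) (_ ∷ pos) (suc j) j∈ σ eq with σ | trans eq (merge-∷ a s j)
... | B ∷ σ′ | eq′ with List.∷-injectiveˡ eq′ | cut-step s pos j j∈ σ′ (List.∷-injectiveʳ eq′)
... | refl | _ , st = _ , skip B st

sum-decrement : (s : Vec ℕ (suc m)) → All (_> 0) s → ∀ j → suc (sum (decrement s j)) ≡ sum (toList s)
sum-decrement (1 ∷ s)           _ zero = refl
sum-decrement (suc (suc _) ∷ s) _ zero = refl
sum-decrement (a ∷ s@(_ ∷ _)) (_ ∷ pos) (suc j) rewrite decrement-∷ a s j =
  trans (sym (ℕ.+-suc a _)) (cong (a +_) (sum-decrement s pos j))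

sum-merge : (s : Vec ℕ (suc m)) → All (_> 0) s → ∀ j → suc (sum (merge s j)) ≡ sum (toList s)
sum-merge (suc a ∷ b ∷ s) _ zero = cong suc (ℕ.+-assoc a b (sum (toList s)))
sum-merge (a ∷ s@(_ ∷ _)) (_ ∷ pos) (suc j) rewrite merge-∷ a s j =
  trans (sym (ℕ.+-suc a _)) (cong (a +_) (sum-merge s pos j))

-- Counting

-- The ground set is a separate parameter, so that partitions of all the shapes in the recurrence
-- lie in one type although their sums are only provably equal.
crossings : ∀ n → List ℕ → List (List (Block n))
crossings n s = filter isNCCrossing? (blockSeqs n s)

∈-crossings⁺ : ∀ s {σ : List (Block n)} → type σ ≡ s → IsNCCrossing σ → σ ∈ crossings n s
∈-crossings⁺ s refl = ∈-filter⁺ isNCCrossing? (∈-blockSeqs⁺ _)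

∈-crossings⁻ : ∀ s {σ : List (Block n)} → σ ∈ crossings n s → type σ ≡ s × IsNCCrossing σ
∈-crossings⁻ {n} s σ∈ = let σ∈′ , c = ∈-filter⁻ isNCCrossing? {xs = blockSeqs n s} σ∈ in ∈-blockSeqs⁻ s σ∈′ , c

crossings-unique : ∀ n s → Unique (crossings n s)
crossings-unique n s = Unique.filter⁺ isNCCrossing? (blockSeqs-unique n s)

T-crossings : ∀ s → sum s ≡ n → T s ≡ length (crossings n s)
T-crossings s refl = refl

Index : ℕ → Set
Index m = Fin (suc m) ⊎ Fin m

kind : Index m → Kind
kind = [ (λ _ → add) , (λ _ → cut) ]′

position : Index m → ℕ
position = [ toℕ , toℕ ]′

index-injective : (p q : Index m) → kind p ≡ kind q → position p ≡ position q → p ≡ q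
index-injective (inj₁ i) (inj₁ j) _ eq = cong inj₁ (Fin.toℕ-injective eq)
index-injective (inj₂ i) (inj₂ j) _ eq = cong inj₂ (Fin.toℕ-injective eq)

module _ (s : Vec ℕ (suc m)) (pos : All (_> 0) s) where

  shape : Index m → List ℕ
  shape = [ decrement s , merge s ]′

  sum-shape : ∀ p → suc (sum (shape p)) ≡ sum (toList s)
  sum-shape (inj₁ i) = sum-decrement s pos i
  sum-shape (inj₂ i) = sum-merge s pos i

  indices₁ : List (Fin (suc m))
  indices₁ = filter (S₁? s) (allFin (suc m))

  indices₂ : List (Fin m)
  indices₂ = filter (S₂? s) (allFin m)

  indices : List (Index m)
  indices = map inj₁ indices₁ ++ map inj₂ indices₂

  indices-unique : Unique indices
  indices-unique = Unique.++⁺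
    (Unique.map⁺ Sum.inj₁-injective (Unique.filter⁺ (S₁? s) (Unique.allFin⁺ (suc m))))
    (Unique.map⁺ Sum.inj₂-injective (Unique.filter⁺ (S₂? s) (Unique.allFin⁺ m)))
    λ (∈₁ , ∈₂) → let _ , _ , eq₁ = ∈-map⁻ inj₁ ∈₁ ; _ , _ , eq₂ = ∈-map⁻ inj₂ ∈₂ in
      contradiction (trans (sym eq₁) eq₂) λ ()

  summands : ∀ n → List (Index m × List (Block n))
  summands n = tagged (crossings n ∘ shape) indices

  summands-unique : ∀ n → Unique (summands n)
  summands-unique n = tagged-unique _ indices-unique (λ p → crossings-unique n (shape p))

  ∈-summands⁻ : ∀ {p} {σ : List (Block n)} → (p , σ) ∈ summands n →
    p ∈ indices × type σ ≡ shape p × IsNCCrossing σ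
  ∈-summands⁻ {p = p} pσ∈ = let p∈ , σ∈ = ∈-tagged⁻ _ indices pσ∈ in p∈ , ∈-crossings⁻ (shape p) σ∈

  Inserts : Index m × List (Block n) → List (Block (suc n)) → Set
  Inserts (p , σ) π = Step (kind p) (position p) s σ π

  insert : ∀ p → p ∈ indices → (σ : List (Block n)) → type σ ≡ shape p → ∃[ π ] Inserts (p , σ) π
  insert p p∈ σ eq with ∈-++⁻ (map inj₁ indices₁) p∈
  ... | inj₁ p∈₁ with ∈-map⁻ inj₁ p∈₁
  ...   | i , i∈ , refl = add-step s pos i (proj₂ (∈-filter⁻ (S₁? s) {xs = allFin (suc m)} i∈)) σ eq
  insert p p∈ σ eq | inj₂ p∈₂ with ∈-map⁻ inj₂ p∈₂
  ...   | i , i∈ , refl = cut-step s pos i (proj₂ (∈-filter⁻ (S₂? s) {xs = allFin m} i∈)) σ eq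

  insertion : ∀ {x} → x ∈ summands n → ∃[ π ] (π ∈ crossings (suc n) (toList s) × Inserts x π)
  insertion {x = p , σ} x∈ =
    let p∈ , eq , c = ∈-summands⁻ x∈
        π , st      = insert p p∈ σ eq
    in π , ∈-crossings⁺ _ (step-type st) (step-crossing st c) , st

  remove : ∀ {π : List (Block (suc n))} → Step k i s σ π → IsNCCrossing σ →
    ∃[ x ] (x ∈ summands n × Inserts x π)
  remove {k = add} {σ = σ} st c with add-index s st
  ... | i , refl , i∈ , eq = (inj₁ i , σ) ,
    ∈-tagged⁺ _ (∈-++⁺ˡ (∈-map⁺ inj₁ (∈-filter⁺ (S₁? s) (∈-allFin i) i∈))) (∈-crossings⁺ _ eq c) , st
  remove {k = cut} {σ = σ} st c with cut-index s st
  ... | i , refl , i∈ , eq = (inj₂ i , σ) ,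
    ∈-tagged⁺ _ (∈-++⁺ʳ (map inj₁ indices₁) (∈-map⁺ inj₂ (∈-filter⁺ (S₂? s) (∈-allFin i) i∈)))
      (∈-crossings⁺ _ eq c) , st

  removal : ∀ {π : List (Block (suc n))} → π ∈ crossings (suc n) (toList s) →
    ∃[ x ] (x ∈ summands n × Inserts x π)
  removal {π = π} π∈ =
    let eq , c               = ∈-crossings⁻ (toList s) π∈
        _ , _ , _ , st , cσ = lowering-crossing s π eq c
    in remove st cσ

  -- `Inserts` is total and injective in both directions: removal is injective because insertion is
  -- functional, and insertion is injective because the result determines kind, index and `σ`.
  length-crossings : ∀ n → length (crossings (suc n) (toList s)) ≡ length (summands n)
  length-crossings n = ℕ.≤-antisym
    (length-≤ (crossings-unique (suc n) (toList s)) (λ π x → Inserts x π) removal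
      λ _ _ st st′ → step-functional st st′ refl refl)
    (length-≤ (summands-unique n) Inserts insertion injective)
    where
    injective : ∀ {x y π} → x ∈ summands n → y ∈ summands n → Inserts x π → Inserts y π → x ≡ y
    injective {p , _} {q , _} x∈ y∈ st st′ =
      let _ , _ , cσ = ∈-summands⁻ x∈ ; _ , _ , cτ = ∈-summands⁻ y∈
          kinds , positions , σ≡τ = step-injective st st′ refl (crossing cσ) (crossing cτ)
      in cong₂ _,_ (index-injective p q kinds positions) σ≡τ

  recurrence : T (toList s) ≡ sumOver (S₁? s) (T ∘ decrement s) + sumOver (S₂? s) (T ∘ merge s)
  recurrence = begin
    T (toList s)
      ≡⟨ T-crossings (toList s) (sym size) ⟩
    length (crossings (suc N) (toList s))
      ≡⟨ length-crossings N ⟩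
    length (summands N)
      ≡⟨ length-tagged _ indices ⟩
    sum (map (length ∘ crossings N ∘ shape) indices)
      ≡⟨ cong sum (List.map-cong T-shape indices) ⟨
    sum (map (T ∘ shape) indices)
      ≡⟨ cong sum (List.map-++ (T ∘ shape) (map inj₁ indices₁) _) ⟩
    sum (map (T ∘ shape) (map inj₁ indices₁) ++ map (T ∘ shape) (map inj₂ indices₂))
      ≡⟨ sum-++ (map (T ∘ shape) (map inj₁ indices₁)) _ ⟩
    sum (map (T ∘ shape) (map inj₁ indices₁)) + sum (map (T ∘ shape) (map inj₂ indices₂))
      ≡⟨ cong₂ (λ xs ys → sum xs + sum ys) (List.map-∘ indices₁) (List.map-∘ indices₂) ⟨
    sumOver (S₁? s) (T ∘ decrement s) + sumOver (S₂? s) (T ∘ merge s)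
      ∎
    where
    open ≡-Reasoning

    N : ℕ
    -- Every shape has this sum, by `sum-shape`; position `zero` exists for every `s`.
    N = sum (decrement s zero)

    size : suc N ≡ sum (toList s)
    size = sum-shape (inj₁ zero)

    T-shape : ∀ p → T (shape p) ≡ length (crossings N (shape p))
    T-shape p = T-crossings (shape p) (ℕ.suc-injective (trans (sum-shape p) (sym size)))

lemma2p12 : (T (1 ∷ []) ≡ 1)
    × (∀ {m} (s : Vec ℕ (suc m)) → All (_> 0) s → toList s ≢ 1 ∷ [] →
    T (toList s) ≡ sumOver (S₁? s) (λ i → T (decrement s i))
    + sumOver (S₂? s) (λ i → T (merge s i)))
lemma2p12 = refl , λ s pos _ → recurrence s pos
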